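{- Let $p$ be a prime and let $q\in U^{(1)}-\{1\}$. If $p\neq 3$ or $q\in U^{(2)}$, then the only $z\in\mathbb{Z}_p$ with $\iota_q(z)=z$ are the trivial fixed points $z=0$ and $z=1$.
   Context: $\mathbb{Z}_p$ is the ring of $p$-adic integers and $U^{(m)}=1+p^m\mathbb{Z}_p$. For $q\in U^{(1)}$, $\iota_q:\mathbb{Z}_p\to\mathbb{Z}_p$ is the unique continuous function with $\iota_q(n)=1+q+\cdots+q^{n-1}$ for all integers $n\ge 0$; thus $\iota_q(z)=(q^z-1)/(q-1)$ for $q\ne 1$. -}

module Defs where

open import Algebra.Bundles using (CommutativeRing; Semiring)
import Algebra.Definitions.RawSemiring as RawSemiringDefs
open import Algebra.Structures using (IsCommutativeRing)
open import Data.Fin.Base as Fin using (Fin; toℕ)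
open import Data.Integer.Base as ℤ using (ℤ; +_; 0ℤ; 1ℤ)
open import Data.Integer.Divisibility.Signed as ℤ∣ using (_∣_; divides)
open import Data.Integer.DivMod using (_/ℕ_; _%ℕ_; a≡a%ℕn+[a/ℕn]*n)
import Data.Integer.Properties as ℤ-Props
open import Data.Integer.Tactic.RingSolver using (solve-∀)
open import Data.Nat.Base as ℕ using (ℕ; zero; suc; NonZero)
import Data.Nat.Divisibility as ℕ∣
import Data.Nat.Properties as ℕ-Props
open import Data.Product.Base using (∃-syntax; _,_)
open import Data.Sum.Base using (inj₁; inj₂)
open import Level using (0ℓ)
open import Relation.Binary.PropositionalEquality
  using (_≡_; refl; sym; trans; cong; cong₂; subst; module ≡-Reasoning)
open import Relation.Unary using (Pred; _∈_)

infix 4 _≡_[mod_]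

record _≡_[mod_] (a b d : ℤ) : Set where
  constructor modEq
  field divides-difference : d ∣ a ℤ.- b
open _≡_[mod_] public

module _ {d : ℤ} where

  private
    by : ∀ {x y} → x ≡ y → d ∣ x → d ∣ y
    by refl h = h

    sub-self : ∀ a → 0ℤ ≡ a ℤ.+ (ℤ.- a)
    sub-self = solve-∀
    sub-swap : ∀ a b → ℤ.- (a ℤ.+ ℤ.- b) ≡ b ℤ.+ (ℤ.- a)
    sub-swap = solve-∀
    sub-trans : ∀ a b c → (a ℤ.+ ℤ.- b) ℤ.+ (b ℤ.+ ℤ.- c) ≡ a ℤ.+ ℤ.- c
    sub-trans = solve-∀
    sub-+ : ∀ a a′ b b′ → (a ℤ.+ ℤ.- a′) ℤ.+ (b ℤ.+ ℤ.- b′)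
                        ≡ (a ℤ.+ b) ℤ.+ ℤ.- (a′ ℤ.+ b′)
    sub-+ = solve-∀
    sub-* : ∀ a a′ b b′ → (a ℤ.+ ℤ.- a′) ℤ.* b ℤ.+ a′ ℤ.* (b ℤ.+ ℤ.- b′)
                        ≡ a ℤ.* b ℤ.+ ℤ.- (a′ ℤ.* b′)
    sub-* = solve-∀
    sub-neg : ∀ a b → ℤ.- (a ℤ.+ ℤ.- b) ≡ (ℤ.- a) ℤ.+ ℤ.- (ℤ.- b)
    sub-neg = solve-∀
    add-sub : ∀ b c → c ≡ (b ℤ.+ c) ℤ.+ ℤ.- b
    add-sub = solve-∀

  mod-reflexive : ∀ {a b} → a ≡ b → a ≡ b [mod d ]
  mod-reflexive {a} refl = modEq (by (sub-self a) (divides 0ℤ refl))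

  mod-refl : ∀ {a} → a ≡ a [mod d ]
  mod-refl = mod-reflexive refl

  mod-sym : ∀ {a b} → a ≡ b [mod d ] → b ≡ a [mod d ]
  mod-sym {a} {b} (modEq h) = modEq (by (sub-swap a b) (ℤ∣.∣m⇒∣-m h))

  mod-trans : ∀ {a b c} → a ≡ b [mod d ] → b ≡ c [mod d ] → a ≡ c [mod d ]
  mod-trans {a} {b} {c} (modEq h) (modEq k) =
    modEq (by (sub-trans a b c) (ℤ∣.∣m∣n⇒∣m+n h k))

  mod-+ : ∀ {a a′ b b′} → a ≡ a′ [mod d ] → b ≡ b′ [mod d ] →
          a ℤ.+ b ≡ a′ ℤ.+ b′ [mod d ]
  mod-+ {a} {a′} {b} {b′} (modEq h) (modEq k) =
    modEq (by (sub-+ a a′ b b′) (ℤ∣.∣m∣n⇒∣m+n h k))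

  mod-* : ∀ {a a′ b b′} → a ≡ a′ [mod d ] → b ≡ b′ [mod d ] →
          a ℤ.* b ≡ a′ ℤ.* b′ [mod d ]
  mod-* {a} {a′} {b} {b′} (modEq h) (modEq k) =
    modEq (by (sub-* a a′ b b′)
      (ℤ∣.∣m∣n⇒∣m+n (ℤ∣.∣m⇒∣m*n b h) (ℤ∣.∣n⇒∣m*n a′ k)))

  mod-neg : ∀ {a b} → a ≡ b [mod d ] → ℤ.- a ≡ ℤ.- b [mod d ]
  mod-neg {a} {b} (modEq h) = modEq (by (sub-neg a b) (ℤ∣.∣m⇒∣-m h))

  mod-add-multiple : ∀ {b c} → d ∣ c → b ℤ.+ c ≡ b [mod d ]
  mod-add-multiple {b} {c} h = modEq (by (add-sub b c) h)

  mod-weaken : ∀ {e a b} → d ∣ e → a ≡ b [mod e ] → a ≡ b [mod d ]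
  mod-weaken h (modEq k) = modEq (ℤ∣.∣-trans h k)

-- ℤₚ is the inverse limit of the rings ℤ/pⁿ. An element is a sequence of
-- integer representatives of its residues, and equality is congruence of
-- the n-th representatives modulo pⁿ for all n.

record ℤₚ (p : ℕ) : Set where
  constructor mkℤₚ
  field
    residue  : ℕ → ℤ
    coherent : ∀ n → residue (suc n) ≡ residue n [mod + (p ℕ.^ n) ]
open ℤₚ public

infix 4 _≈_

record _≈_ {p : ℕ} (x y : ℤₚ p) : Set where
  constructor mk≈
  field residue-≡ : ∀ n → residue x n ≡ residue y n [mod + (p ℕ.^ n) ]
open _≈_ public

module _ {p : ℕ} where

  infixl 6 _+ₚ_
  infixl 7 _*ₚ_
  infix  8 -ₚ_

  _+ₚ_ : ℤₚ p → ℤₚ p → ℤₚ p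
  (mkℤₚ x cx) +ₚ (mkℤₚ y cy) = mkℤₚ (λ n → x n ℤ.+ y n) (λ n → mod-+ (cx n) (cy n))

  _*ₚ_ : ℤₚ p → ℤₚ p → ℤₚ p
  (mkℤₚ x cx) *ₚ (mkℤₚ y cy) = mkℤₚ (λ n → x n ℤ.* y n) (λ n → mod-* (cx n) (cy n))

  -ₚ_ : ℤₚ p → ℤₚ p
  -ₚ (mkℤₚ x cx) = mkℤₚ (λ n → ℤ.- x n) (λ n → mod-neg (cx n))

  fromℤ : ℤ → ℤₚ p
  fromℤ k = mkℤₚ (λ _ → k) (λ _ → mod-refl)

  fromℕ : ℕ → ℤₚ p
  fromℕ k = fromℤ (+ k)

  0# : ℤₚ p
  0# = fromℕ 0

  1# : ℤₚ p
  1# = fromℕ 1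

  private
    pointwise : {x y : ℤₚ p} → (∀ n → residue x n ≡ residue y n) → x ≈ y
    pointwise h = mk≈ (λ n → mod-reflexive (h n))

  isCommutativeRing : IsCommutativeRing (_≈_ {p}) _+ₚ_ _*ₚ_ -ₚ_ 0# 1#
  isCommutativeRing = record
    { isRing = record
      { +-isAbelianGroup = record
        { isGroup = record
          { isMonoid = record
            { isSemigroup = record
              { isMagma = record
                { isEquivalence = record
                  { refl  = pointwise (λ _ → refl)
                  ; sym   = λ h → mk≈ (λ n → mod-sym (residue-≡ h n))
                  ; trans = λ h k → mk≈ (λ n → mod-trans (residue-≡ h n) (residue-≡ k n))
                  }
                ; ∙-cong = λ h k → mk≈ (λ n → mod-+ (residue-≡ h n) (residue-≡ k n))
                }
              ; assoc = λ x y z → pointwise (λ n →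
                  ℤ-Props.+-assoc (residue x n) (residue y n) (residue z n))
              }
            ; identity = (λ x → pointwise (λ n → ℤ-Props.+-identityˡ (residue x n)))
                       , (λ x → pointwise (λ n → ℤ-Props.+-identityʳ (residue x n)))
            }
          ; inverse = (λ x → pointwise (λ n → ℤ-Props.+-inverseˡ (residue x n)))
                    , (λ x → pointwise (λ n → ℤ-Props.+-inverseʳ (residue x n)))
          ; ⁻¹-cong = λ h → mk≈ (λ n → mod-neg (residue-≡ h n))
          }
        ; comm = λ x y → pointwise (λ n → ℤ-Props.+-comm (residue x n) (residue y n))
        }
      ; *-cong = λ h k → mk≈ (λ n → mod-* (residue-≡ h n) (residue-≡ k n))
      ; *-assoc = λ x y z → pointwise (λ n →
          ℤ-Props.*-assoc (residue x n) (residue y n) (residue z n))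
      ; *-identity = (λ x → pointwise (λ n → ℤ-Props.*-identityˡ (residue x n)))
                   , (λ x → pointwise (λ n → ℤ-Props.*-identityʳ (residue x n)))
      ; distrib = (λ x y z → pointwise (λ n →
                    ℤ-Props.*-distribˡ-+ (residue x n) (residue y n) (residue z n)))
                , (λ x y z → pointwise (λ n →
                    ℤ-Props.*-distribʳ-+ (residue x n) (residue y n) (residue z n)))
      }
    ; *-comm = λ x y → pointwise (λ n → ℤ-Props.*-comm (residue x n) (residue y n))
    }

ℤₚ-commutativeRing : ℕ → CommutativeRing 0ℓ 0ℓ
ℤₚ-commutativeRing p = record { isCommutativeRing = isCommutativeRing {p} }

module _ {p : ℕ} where

  open RawSemiringDefs (Semiring.rawSemiring
    (CommutativeRing.semiring (ℤₚ-commutativeRing p)))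
    using (sum) renaming (_^_ to _^ₚ_) public

  infix 4 _≈_[modp^_]

  -- x ∈ y + pᵐℤₚ
  _≈_[modp^_] : ℤₚ p → ℤₚ p → ℕ → Set
  x ≈ y [modp^ m ] = ∃[ w ] x ≈ y +ₚ fromℕ (p ℕ.^ m) *ₚ w

  U : ℕ → Pred (ℤₚ p) 0ℓ
  U m q = q ≈ 1# [modp^ m ]

  -- Continuity for the p-adic topology, whose basic neighbourhoods of x are
  -- the cosets x + pᵐℤₚ.
  Continuous : (ℤₚ p → ℤₚ p) → Set
  Continuous f =
    ∀ x n → ∃[ m ] (∀ y → y ≈ x [modp^ m ] → f y ≈ f x [modp^ n ])

  geometricSum : ℤₚ p → ℕ → ℤₚ p
  geometricSum q n = sum {n} (λ i → q ^ₚ toℕ i)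

  -- The property characterising ι_q. For q ∈ U 1 exactly one function has it,
  -- up to pointwise _≈_: see ι-isBracket and bracket-unique.
  record IsBracket (q : ℤₚ p) (f : ℤₚ p → ℤₚ p) : Set where
    field
      continuous : Continuous f
      on-ℕ       : ∀ n → f (fromℕ n) ≈ geometricSum q n
  open IsBracket public

-- The rest of the module proves that ι_q exists and is unique. Existence rests
-- on pⁿ ∣ 1 + x + ⋯ + x^(pⁿ-1) for x ≡ 1 mod p, so that the residue of ι_q(z)
-- modulo pⁿ depends only on those of q and z.

geomℤ : ℤ → ℕ → ℤ
geomℤ x zero    = 0ℤ
geomℤ x (suc n) = 1ℤ ℤ.+ x ℤ.* geomℤ x n

geomℤ-cong : ∀ {d x y} n → x ≡ y [mod d ] → geomℤ x n ≡ geomℤ y n [mod d ]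
geomℤ-cong zero    h = mod-refl
geomℤ-cong (suc n) h = mod-+ (mod-refl {a = 1ℤ}) (mod-* h (geomℤ-cong n h))

geomℤ-one : ∀ n → geomℤ 1ℤ n ≡ + n
geomℤ-one zero    = refl
geomℤ-one (suc n) = cong (λ g → 1ℤ ℤ.+ g) (trans (ℤ-Props.*-identityˡ _) (geomℤ-one n))

geomℤ-+ : ∀ x m n → geomℤ x (m ℕ.+ n) ≡ geomℤ x m ℤ.+ (x ℤ.^ m) ℤ.* geomℤ x n
geomℤ-+ x zero    n = base (geomℤ x n)
  where
  base : ∀ g → g ≡ 0ℤ ℤ.+ 1ℤ ℤ.* g
  base = solve-∀
geomℤ-+ x (suc m) n =
  trans (cong (λ g → 1ℤ ℤ.+ x ℤ.* g) (geomℤ-+ x m n)) (step x (geomℤ x m) (x ℤ.^ m) (geomℤ x n))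
  where
  step : ∀ x g y h → 1ℤ ℤ.+ x ℤ.* (g ℤ.+ y ℤ.* h) ≡ (1ℤ ℤ.+ x ℤ.* g) ℤ.+ (x ℤ.* y) ℤ.* h
  step = solve-∀

geomℤ-* : ∀ x n m → geomℤ x (n ℕ.* m) ≡ geomℤ x m ℤ.* geomℤ (x ℤ.^ m) n
geomℤ-* x zero    m = sym (ℤ-Props.*-zeroʳ (geomℤ x m))
geomℤ-* x (suc n) m = begin
  geomℤ x (m ℕ.+ n ℕ.* m)
    ≡⟨ geomℤ-+ x m (n ℕ.* m) ⟩
  geomℤ x m ℤ.+ (x ℤ.^ m) ℤ.* geomℤ x (n ℕ.* m)
    ≡⟨ cong (λ g → geomℤ x m ℤ.+ (x ℤ.^ m) ℤ.* g) (geomℤ-* x n m) ⟩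
  geomℤ x m ℤ.+ (x ℤ.^ m) ℤ.* (geomℤ x m ℤ.* geomℤ (x ℤ.^ m) n)
    ≡⟨ step (geomℤ x m) (x ℤ.^ m) (geomℤ (x ℤ.^ m) n) ⟩
  geomℤ x m ℤ.* (1ℤ ℤ.+ (x ℤ.^ m) ℤ.* geomℤ (x ℤ.^ m) n) ∎
  where
  open ≡-Reasoning
  step : ∀ g y h → g ℤ.+ y ℤ.* (g ℤ.* h) ≡ g ℤ.* (1ℤ ℤ.+ y ℤ.* h)
  step = solve-∀

^-mod-one : ∀ {d x} n → x ≡ 1ℤ [mod d ] → x ℤ.^ n ≡ 1ℤ [mod d ]
^-mod-one zero    h = mod-refl
^-mod-one (suc n) h = mod-* h (^-mod-one n h)

mod-zero⇒∣ : ∀ {a d} → a ≡ 0ℤ [mod d ] → d ∣ a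
mod-zero⇒∣ {a} (modEq h) = subst (_ ∣_) (ℤ-Props.+-identityʳ a) h

mod-1 : ∀ {a b} → a ≡ b [mod + 1 ]
mod-1 {a} {b} = modEq (divides (a ℤ.- b) (sym (ℤ-Props.*-identityʳ (a ℤ.- b))))

pow∣geomℤ : ∀ p n {x} → x ≡ 1ℤ [mod + p ] → + (p ℕ.^ n) ∣ geomℤ x (p ℕ.^ n)
pow∣geomℤ p zero    {x} h = mod-zero⇒∣ mod-1
pow∣geomℤ p (suc n) {x} h =
  subst (+ (p ℕ.^ suc n) ∣_) (sym (geomℤ-* x p (p ℕ.^ n)))
    (subst (_∣ geomℤ x (p ℕ.^ n) ℤ.* geomℤ y p) pⁿp≡
      (ℤ∣.∣-trans (ℤ∣.*-monoˡ-∣ (+ p) (pow∣geomℤ p n h))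
                  (ℤ∣.*-monoʳ-∣ (geomℤ x (p ℕ.^ n)) p∣)))
  where
  y = x ℤ.^ (p ℕ.^ n)
  p∣ : + p ∣ geomℤ y p
  p∣ = mod-zero⇒∣ (mod-trans (geomℤ-cong p (^-mod-one (p ℕ.^ n) h))
         (mod-trans (mod-reflexive (geomℤ-one p))
           (modEq (subst (+ p ∣_) (sym (ℤ-Props.+-identityʳ (+ p))) ℤ∣.∣-refl))))
  pⁿp≡ : + (p ℕ.^ n) ℤ.* + p ≡ + (p ℕ.^ suc n)
  pⁿp≡ = trans (sym (ℤ-Props.pos-* (p ℕ.^ n) p)) (cong +_ (ℕ-Props.*-comm (p ℕ.^ n) p))

private
  geomℤ-index-≤ : ∀ p n {x} a b → x ≡ 1ℤ [mod + p ] → a ℕ.≤ b →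
                  + b ≡ + a [mod + (p ℕ.^ n) ] →
                  geomℤ x b ≡ geomℤ x a [mod + (p ℕ.^ n) ]
  geomℤ-index-≤ p n {x} a b h a≤b (modEq k)
    with ℤ∣.∣⇒∣ᵤ (subst (+ (p ℕ.^ n) ∣_) (trans (ℤ-Props.m-n≡m⊖n b a) (ℤ-Props.⊖-≥ a≤b)) k)
  ... | ℕ∣.divides c eq =
    mod-trans (mod-reflexive (trans (cong (geomℤ x) b≡) (geomℤ-+ x a (c ℕ.* p ℕ.^ n))))
      (mod-add-multiple (ℤ∣.∣n⇒∣m*n (x ℤ.^ a)
        (subst (+ (p ℕ.^ n) ∣_) (sym (geomℤ-* x c (p ℕ.^ n)))
          (ℤ∣.∣m⇒∣m*n _ (pow∣geomℤ p n h)))))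
    where
    b≡ : b ≡ a ℕ.+ c ℕ.* p ℕ.^ n
    b≡ = trans (sym (ℕ-Props.m+[n∸m]≡n a≤b)) (cong (a ℕ.+_) eq)

geomℤ-index : ∀ p n {x} a b → x ≡ 1ℤ [mod + p ] →
              + a ≡ + b [mod + (p ℕ.^ n) ] →
              geomℤ x a ≡ geomℤ x b [mod + (p ℕ.^ n) ]
geomℤ-index p n a b h e with ℕ-Props.≤-total a b
... | inj₁ a≤b = mod-sym (geomℤ-index-≤ p n a b h a≤b (mod-sym e))
... | inj₂ b≤a = geomℤ-index-≤ p n b a h b≤a e

pow∣pow : ∀ p m n → + (p ℕ.^ m) ∣ + (p ℕ.^ (m ℕ.+ n))
pow∣pow p m n = subst (+ (p ℕ.^ m) ∣_)
  (trans (sym (ℤ-Props.pos-* (p ℕ.^ m) (p ℕ.^ n))) (cong +_ (sym (ℕ-Props.^-distribˡ-+-* p m n))))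
  (ℤ∣.∣m⇒∣m*n (+ (p ℕ.^ n)) ℤ∣.∣-refl)

module _ {p : ℕ} where

  residue-stable : ∀ (x : ℤₚ p) m n →
                   residue x (m ℕ.+ n) ≡ residue x m [mod + (p ℕ.^ m) ]
  residue-stable x m zero    = mod-reflexive (cong (residue x) (ℕ-Props.+-identityʳ m))
  residue-stable x m (suc n) = mod-trans
    (mod-reflexive (cong (residue x) (ℕ-Props.+-suc m n)))
    (mod-trans (mod-weaken (pow∣pow p m n) (coherent x (m ℕ.+ n)))
               (residue-stable x m n))

  modp^⇒residue : ∀ (x y : ℤₚ p) m → x ≈ y [modp^ m ] →
                  residue x m ≡ residue y m [mod + (p ℕ.^ m) ]
  modp^⇒residue x y m (w , h) =
    mod-trans (residue-≡ h m) (mod-add-multiple (ℤ∣.∣m⇒∣m*n (residue w m) ℤ∣.∣-refl))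

  U₁-residue : ∀ {q : ℤₚ p} → q ∈ U 1 → ∀ n → residue q (suc n) ≡ 1ℤ [mod + p ]
  U₁-residue {q} q∈U n = mod-weaken p∣ (mod-trans
    (residue-stable q 1 n) (modp^⇒residue q 1# 1 q∈U))
    where
    p∣ : + p ∣ + (p ℕ.^ 1)
    p∣ = subst (+ p ∣_) (cong +_ (sym (ℕ-Props.*-identityʳ p))) ℤ∣.∣-refl

  residue-geometricSum : ∀ (q : ℤₚ p) n k →
                         residue (geometricSum q n) k ≡ geomℤ (residue q k) n
  residue-geometricSum q n k =
    trans (go n _ 1ℤ (λ i → trans (pow (toℕ i)) (sym (ℤ-Props.*-identityˡ _))))
          (ℤ-Props.*-identityˡ _)
    where
    x = residue q k
    pow : ∀ j → residue (q ^ₚ j) k ≡ x ℤ.^ j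
    pow zero    = refl
    pow (suc j) = cong (x ℤ.*_) (pow j)
    step : ∀ c x g → c ℤ.* 1ℤ ℤ.+ (c ℤ.* x) ℤ.* g ≡ c ℤ.* (1ℤ ℤ.+ x ℤ.* g)
    step = solve-∀
    go : ∀ n (f : Fin n → ℤₚ p) c → (∀ i → residue (f i) k ≡ c ℤ.* x ℤ.^ toℕ i) →
         residue (sum f) k ≡ c ℤ.* geomℤ x n
    go zero    f c h = sym (ℤ-Props.*-zeroʳ c)
    go (suc n) f c h = trans
      (cong₂ ℤ._+_ (h Fin.zero)
        (go n (λ i → f (Fin.suc i)) (c ℤ.* x)
          (λ i → trans (h (Fin.suc i)) (sym (ℤ-Props.*-assoc c x (x ℤ.^ toℕ i))))))
      (step c x (geomℤ x n))

module _ {p : ℕ} .{{_ : NonZero p}} where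

  residue⇒modp^ : ∀ (x y : ℤₚ p) m → residue x m ≡ residue y m [mod + (p ℕ.^ m) ] →
                  x ≈ y [modp^ m ]
  residue⇒modp^ x y m h = mkℤₚ w w-coherent , mk≈ x≈
    where
    instance
      pᵐ≢0 : NonZero (p ℕ.^ m)
      pᵐ≢0 = ℕ-Props.m^n≢0 p m
    P = + (p ℕ.^ m)
    D : ℕ → ℤ
    D n = residue x (m ℕ.+ n) ℤ.- residue y (m ℕ.+ n)
    P∣D : ∀ n → P ∣ D n
    P∣D n = divides-difference (mod-trans (residue-stable x m n)
      (mod-trans h (mod-sym (residue-stable y m n))))
    w : ℕ → ℤ
    w n = ℤ∣.quotient (P∣D n)
    D≡ : ∀ n → D n ≡ P ℤ.* w n
    D≡ n = trans (_∣_.equality (P∣D n)) (ℤ-Props.*-comm (w n) P)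
    D-coherent : ∀ n → D (suc n) ≡ D n [mod + (p ℕ.^ (m ℕ.+ n)) ]
    D-coherent n rewrite ℕ-Props.+-suc m n =
      mod-+ (coherent x (m ℕ.+ n)) (mod-neg (coherent y (m ℕ.+ n)))
    factor : ∀ P a b → P ℤ.* a ℤ.+ ℤ.- (P ℤ.* b) ≡ P ℤ.* (a ℤ.+ ℤ.- b)
    factor = solve-∀
    w-coherent : ∀ n → w (suc n) ≡ w n [mod + (p ℕ.^ n) ]
    w-coherent n = modEq (ℤ∣.*-cancelˡ-∣ P
      (subst (P ℤ.* + (p ℕ.^ n) ∣_)
        (trans (cong₂ ℤ._-_ (D≡ (suc n)) (D≡ n)) (factor P (w (suc n)) (w n)))
        (subst (_∣ D (suc n) ℤ.- D n)
          (trans (cong +_ (ℕ-Props.^-distribˡ-+-* p m n)) (ℤ-Props.pos-* (p ℕ.^ m) (p ℕ.^ n)))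
          (divides-difference (D-coherent n)))))
    stable : ∀ (v : ℤₚ p) n → residue v (m ℕ.+ n) ≡ residue v n [mod + (p ℕ.^ n) ]
    stable v n rewrite ℕ-Props.+-comm m n = residue-stable v n m
    rearrange : ∀ a b → a ≡ b ℤ.+ (a ℤ.+ ℤ.- b)
    rearrange = solve-∀
    x≈ : ∀ n → residue x n ≡ residue y n ℤ.+ P ℤ.* w n [mod + (p ℕ.^ n) ]
    x≈ n = mod-trans (mod-sym (stable x n))
      (mod-trans (mod-reflexive (trans (rearrange (residue x (m ℕ.+ n)) (residue y (m ℕ.+ n)))
                                       (cong (λ d → residue y (m ℕ.+ n) ℤ.+ d) (D≡ n))))
                 (mod-+ (stable y n) mod-refl))

  approx : ℤₚ p → ℕ → ℕ
  approx z n = (residue z n %ℕ (p ℕ.^ n)) {{ℕ-Props.m^n≢0 p n}}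

  approx-≡ : ∀ z n → + approx z n ≡ residue z n [mod + (p ℕ.^ n) ]
  approx-≡ z n = mod-sym (mod-trans
    (mod-reflexive (a≡a%ℕn+[a/ℕn]*n (residue z n) (p ℕ.^ n)))
    (mod-add-multiple (ℤ∣.∣n⇒∣m*n (residue z n /ℕ (p ℕ.^ n)) ℤ∣.∣-refl)))
    where
    instance
      pⁿ≢0 : NonZero (p ℕ.^ n)
      pⁿ≢0 = ℕ-Props.m^n≢0 p n

  approx-weaken : ∀ z m k → + approx z (m ℕ.+ k) ≡ residue z m [mod + (p ℕ.^ m) ]
  approx-weaken z m k =
    mod-trans (mod-weaken (pow∣pow p m k) (approx-≡ z (m ℕ.+ k))) (residue-stable z m k)

  approx-close : ∀ z m k → fromℕ (approx z (m ℕ.+ k)) ≈ z [modp^ m ]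
  approx-close z m k = residue⇒modp^ (fromℕ (approx z (m ℕ.+ k))) z m (approx-weaken z m k)

  module _ (q : ℤₚ p) (q∈U : q ∈ U 1) where

    private
      index : ∀ n a b → + a ≡ + b [mod + (p ℕ.^ n) ] →
              geomℤ (residue q n) a ≡ geomℤ (residue q n) b [mod + (p ℕ.^ n) ]
      index zero    a b h = mod-1
      index (suc n) a b h = geomℤ-index p (suc n) a b (U₁-residue q∈U n) h

    ι : ℤₚ p → ℤₚ p
    ι z = mkℤₚ (λ n → geomℤ (residue q n) (approx z n)) (λ n →
      mod-trans (geomℤ-cong (approx z (suc n)) (coherent q n))
        (index n (approx z (suc n)) (approx z n)
          (mod-trans (mod-weaken (p^n∣ n) (approx-≡ z (suc n)))
            (mod-trans (coherent z n) (mod-sym (approx-≡ z n))))))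
      where
      p^n∣ : ∀ n → + (p ℕ.^ n) ∣ + (p ℕ.^ suc n)
      p^n∣ n = subst (λ k → + (p ℕ.^ n) ∣ + (p ℕ.^ k)) (ℕ-Props.+-comm n 1) (pow∣pow p n 1)

    ι-isBracket : IsBracket q ι
    ι-isBracket = record
      { continuous = λ x n → n , λ y h → residue⇒modp^ (ι y) (ι x) n
          (index n (approx y n) (approx x n)
            (mod-trans (approx-≡ y n)
              (mod-trans (modp^⇒residue y x n h) (mod-sym (approx-≡ x n)))))
      ; on-ℕ = λ n → mk≈ (λ k → mod-trans
          (index k (approx (fromℕ n) k) n (approx-≡ (fromℕ n) k))
          (mod-reflexive (sym (residue-geometricSum q n k))))
      }

  bracket-unique : ∀ {q f g} → IsBracket q f → IsBracket q g → ∀ z → f z ≈ g z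
  bracket-unique {q} {f} {g} F G z = mk≈ λ n →
    let (m₁ , near₁) = continuous F z n
        (m₂ , near₂) = continuous G z n
        N = approx z (m₁ ℕ.+ m₂)
        close₁ = approx-close z m₁ m₂
        close₂ = subst (λ M → fromℕ (approx z M) ≈ z [modp^ m₂ ])
                   (ℕ-Props.+-comm m₂ m₁) (approx-close z m₂ m₁)
    in mod-trans (mod-sym (modp^⇒residue (f (fromℕ N)) (f z) n (near₁ (fromℕ N) close₁)))
         (mod-trans (residue-≡ (on-ℕ F N) n)
           (mod-trans (mod-sym (residue-≡ (on-ℕ G N) n))
             (modp^⇒residue (g (fromℕ N)) (g z) n (near₂ (fromℕ N) close₂))))

{-# OPTIONS --safe #-}
module Submission where

open import Defs
open import Data.Nat.Base using (ℕ)
open import Data.Nat.Primality using (Prime)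
open import Data.Sum.Base using (_⊎_)
open import Function.Bundles using (_⇔_)
open import Relation.Binary.PropositionalEquality using (_≢_)
open import Relation.Nullary.Negation using (¬_)
open import Relation.Unary using (_∈_)

open import Algebra.Structures using (IsCommutativeRing)
open import Data.Empty using (⊥-elim)
open import Data.Integer.Base using (ℤ; +_; 0ℤ; 1ℤ; _+_; _*_; _-_; -_; _^_) renaming (∣_∣ to abs)
open import Data.Integer.Divisibility.Signed
open import Data.Integer.Properties as ℤ using (pos-*)
open import Data.Integer.Tactic.RingSolver using (solve-∀)
open import Data.Nat.Base as ℕ using (zero; suc; s≤s; z≤n; NonZero)
open import Data.Nat.Combinatorics using (_C_; nCn≡1; nC1≡n; nCk≡nC[n∸k]; nCk+nC[k+1]≡[n+1]C[k+1]; k>n⇒nCk≡0)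
import Data.Nat.Divisibility as ℕ∣
open import Data.Nat.Induction using (<-rec)
open import Data.Nat.Primality using (euclidsLemma; prime⇒nonZero; prime⇒nonTrivial)
import Data.Nat.Properties as ℕ
import Data.Nat.Tactic.RingSolver as ℕ-Solver
open import Data.Product.Base using (∃-syntax; _×_; _,_)
open import Data.Sum.Base using (inj₁; inj₂; [_,_]′)
open import Function.Bundles using (mk⇔)
open import Relation.Binary.PropositionalEquality
open import Relation.Nullary using (yes; no; contradiction)
open import Relation.Nullary.Decidable using (decidable-stable; toSum)

-- For n ∈ ℕ and x = 1 + t the binomial theorem gives
--   2 (1 + x + ⋯ + x^(n-1) - n) = n (n-1) t + Σ_{k ≥ 3} 2 C(n,k) t^(k-1),
-- and k (k-1) C(n,k) = n (n-1) C(n-2,k-2) shows that each term with k ≥ 3 is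
-- divisible by p n (n-1) t in ℤ₍ₚ₎, because k (k-1) contains fewer factors p than
-- 2 t^(k-2); only p = 3 needs 9 ∣ t for this. Hence if pᴺ divides
-- 1 + x + ⋯ + x^(n-1) - n, it divides n (n-1) (x-1). Applied to integer
-- approximations n of z and x of q, a fixed point satisfies z (z-1) (q-1) = 0.

-- Absorption identities for binomial coefficients.

nC0≡1 : ∀ n → n C 0 ≡ 1
nC0≡1 n = trans (nCk≡nC[n∸k] {0} {n} z≤n) (nCn≡1 n)

-- Induction on `n` by Pascal's rule. The factor `k + 2` of the first summand is split as
-- `(k + 1) + 1`, so that the induction hypothesis applies at both `k` and `k + 1`.
C-absorption : ∀ n k → suc k ℕ.* (suc n C suc k) ≡ suc n ℕ.* (n C k)
C-absorption n zero = begin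
  1 ℕ.* (suc n C 1)    ≡⟨ cong (1 ℕ.*_) (nC1≡n (suc n)) ⟩
  1 ℕ.* suc n          ≡⟨ ℕ.*-comm 1 (suc n) ⟩
  suc n ℕ.* 1          ≡⟨ cong (suc n ℕ.*_) (nC0≡1 n) ⟨
  suc n ℕ.* (n C 0)    ∎
  where open ≡-Reasoning
C-absorption zero (suc k) = begin
  suc (suc k) ℕ.* (1 C suc (suc k))  ≡⟨ cong (suc (suc k) ℕ.*_) (k>n⇒nCk≡0 {1} {suc (suc k)} (s≤s (s≤s z≤n))) ⟩
  suc (suc k) ℕ.* 0                  ≡⟨ ℕ.*-zeroʳ (suc (suc k)) ⟩
  1 ℕ.* 0                            ≡⟨ cong (1 ℕ.*_) (k>n⇒nCk≡0 {0} {suc k} (s≤s z≤n)) ⟨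
  1 ℕ.* (0 C suc k)                  ∎
  where open ≡-Reasoning
C-absorption (suc n) (suc k) = begin
  suc (suc k) ℕ.* (suc (suc n) C suc (suc k))
    ≡⟨ cong (suc (suc k) ℕ.*_) (nCk+nC[k+1]≡[n+1]C[k+1] (suc n) (suc k)) ⟨
  suc (suc k) ℕ.* (a ℕ.+ (suc n C suc (suc k)))
    ≡⟨ expand k a (suc n C suc (suc k)) ⟩
  suc k ℕ.* a ℕ.+ a ℕ.+ suc (suc k) ℕ.* (suc n C suc (suc k))
    ≡⟨ cong₂ (λ u v → u ℕ.+ a ℕ.+ v) (C-absorption n k) (C-absorption n (suc k)) ⟩
  suc n ℕ.* (n C k) ℕ.+ a ℕ.+ suc n ℕ.* (n C suc k)
    ≡⟨ collect n (n C k) (n C suc k) a ⟩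
  suc n ℕ.* ((n C k) ℕ.+ (n C suc k)) ℕ.+ a
    ≡⟨ cong (λ u → suc n ℕ.* u ℕ.+ a) (nCk+nC[k+1]≡[n+1]C[k+1] n k) ⟩
  suc n ℕ.* a ℕ.+ a
    ≡⟨ ℕ.+-comm (suc n ℕ.* a) a ⟩
  suc (suc n) ℕ.* a ∎
  where
  open ≡-Reasoning
  a = suc n C suc k
  expand : ∀ k a b → suc (suc k) ℕ.* (a ℕ.+ b) ≡ suc k ℕ.* a ℕ.+ a ℕ.+ suc (suc k) ℕ.* b
  expand = ℕ-Solver.solve-∀
  collect : ∀ n b c a → suc n ℕ.* b ℕ.+ a ℕ.+ suc n ℕ.* c ≡ suc n ℕ.* (b ℕ.+ c) ℕ.+ a
  collect = ℕ-Solver.solve-∀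

C-absorption₂ : ∀ n k → (2 ℕ.+ k) ℕ.* (1 ℕ.+ k) ℕ.* ((2 ℕ.+ n) C (2 ℕ.+ k))
                      ≡ (2 ℕ.+ n) ℕ.* (1 ℕ.+ n) ℕ.* (n C k)
C-absorption₂ n k = begin
  (2 ℕ.+ k) ℕ.* (1 ℕ.+ k) ℕ.* a      ≡⟨ swap (2 ℕ.+ k) (1 ℕ.+ k) a ⟩
  (1 ℕ.+ k) ℕ.* ((2 ℕ.+ k) ℕ.* a)    ≡⟨ cong ((1 ℕ.+ k) ℕ.*_) (C-absorption (suc n) (suc k)) ⟩
  (1 ℕ.+ k) ℕ.* ((2 ℕ.+ n) ℕ.* b)    ≡⟨ swap′ (1 ℕ.+ k) (2 ℕ.+ n) b ⟩
  (2 ℕ.+ n) ℕ.* ((1 ℕ.+ k) ℕ.* b)    ≡⟨ cong ((2 ℕ.+ n) ℕ.*_) (C-absorption n k) ⟩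
  (2 ℕ.+ n) ℕ.* ((1 ℕ.+ n) ℕ.* (n C k)) ≡⟨ ℕ.*-assoc (2 ℕ.+ n) (1 ℕ.+ n) (n C k) ⟨
  (2 ℕ.+ n) ℕ.* (1 ℕ.+ n) ℕ.* (n C k) ∎
  where
  open ≡-Reasoning
  a = (2 ℕ.+ n) C (2 ℕ.+ k)
  b = (1 ℕ.+ n) C (1 ℕ.+ k)
  swap : ∀ x y z → x ℕ.* y ℕ.* z ≡ y ℕ.* (x ℕ.* z)
  swap = ℕ-Solver.solve-∀
  swap′ : ∀ x y z → x ℕ.* (y ℕ.* z) ≡ y ℕ.* (x ℕ.* z)
  swap′ = ℕ-Solver.solve-∀

-- The quotient is C(n-2,k-2), by absorbing twice; the `k` of the name is `2 + k` here. For `n`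
-- equal to 0 or 1 the binomial coefficient vanishes.
n[n-1]∣k[k-1]nCk : ∀ n k → + n * (+ n - 1ℤ) ∣ + ((2 ℕ.+ k) ℕ.* (1 ℕ.+ k)) * + (n C (2 ℕ.+ k))
n[n-1]∣k[k-1]nCk 0 k = ∣n⇒∣m*n (+ ((2 ℕ.+ k) ℕ.* (1 ℕ.+ k)))
  (∣-reflexive (cong +_ (sym (k>n⇒nCk≡0 {0} {2 ℕ.+ k} (s≤s z≤n)))))
n[n-1]∣k[k-1]nCk 1 k = ∣n⇒∣m*n (+ ((2 ℕ.+ k) ℕ.* (1 ℕ.+ k)))
  (∣-reflexive (cong +_ (sym (k>n⇒nCk≡0 {1} {2 ℕ.+ k} (s≤s (s≤s z≤n))))))
n[n-1]∣k[k-1]nCk (suc (suc n)) k = divides (+ (n C k)) (begin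
  + ((2 ℕ.+ k) ℕ.* (1 ℕ.+ k)) * + ((2 ℕ.+ n) C (2 ℕ.+ k))
    ≡⟨ pos-* ((2 ℕ.+ k) ℕ.* (1 ℕ.+ k)) ((2 ℕ.+ n) C (2 ℕ.+ k)) ⟨
  + ((2 ℕ.+ k) ℕ.* (1 ℕ.+ k) ℕ.* ((2 ℕ.+ n) C (2 ℕ.+ k)))
    ≡⟨ cong +_ (C-absorption₂ n k) ⟩
  + ((2 ℕ.+ n) ℕ.* (1 ℕ.+ n) ℕ.* (n C k))
    ≡⟨ pos-* ((2 ℕ.+ n) ℕ.* (1 ℕ.+ n)) (n C k) ⟩
  + ((2 ℕ.+ n) ℕ.* (1 ℕ.+ n)) * + (n C k)
    ≡⟨ cong (_* + (n C k)) (pos-* (2 ℕ.+ n) (1 ℕ.+ n)) ⟩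
  + (2 ℕ.+ n) * + (1 ℕ.+ n) * + (n C k)
    ≡⟨ ℤ.*-comm (+ (2 ℕ.+ n) * + (1 ℕ.+ n)) (+ (n C k)) ⟩
  + (n C k) * (+ (2 ℕ.+ n) * + (1 ℕ.+ n)) ∎)
  where open ≡-Reasoning

2*nC2 : ∀ n → + 2 * + (n C 2) ≡ + n * (+ n - 1ℤ)
2*nC2 0 = refl
2*nC2 1 = refl
2*nC2 (suc (suc n)) = begin
  + 2 * + ((2 ℕ.+ n) C 2)                ≡⟨ pos-* 2 ((2 ℕ.+ n) C 2) ⟨
  + (2 ℕ.* ((2 ℕ.+ n) C 2))              ≡⟨ cong +_ (C-absorption (1 ℕ.+ n) 1) ⟩
  + ((2 ℕ.+ n) ℕ.* ((1 ℕ.+ n) C 1))      ≡⟨ cong (λ c → + ((2 ℕ.+ n) ℕ.* c)) (nC1≡n (1 ℕ.+ n)) ⟩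
  + ((2 ℕ.+ n) ℕ.* (1 ℕ.+ n))            ≡⟨ pos-* (2 ℕ.+ n) (1 ℕ.+ n) ⟩
  + (2 ℕ.+ n) * + (1 ℕ.+ n)              ∎
  where open ≡-Reasoning

-- Binomial expansion of the geometric sum.

-- binomialTail t j n = Σ_{k ≥ j} C(n,k) t^(k-j)
binomialTail : ℤ → ℕ → ℕ → ℤ
binomialTail t zero    n       = (1ℤ + t) ^ n
binomialTail t (suc j) zero    = 0ℤ
binomialTail t (suc j) (suc n) = binomialTail t (suc j) n + binomialTail t j n

-- Splits off the term k = j. The definition recurses along Pascal's rule and so never divides by a
-- power of `t`; this equation recovers the description as a sum.
binomialTail-step : ∀ t j n → binomialTail t j n ≡ + (n C j) + t * binomialTail t (suc j) n
binomialTail-step t zero zero = sym (cong (_+_ 1ℤ) (ℤ.*-zeroʳ t))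
binomialTail-step t zero (suc n) = begin
  (1ℤ + t) * y               ≡⟨ expand t y ⟩
  y + t * y                  ≡⟨ cong (_+ t * y) (binomialTail-step t zero n) ⟩
  + (n C 0) + t * g + t * y  ≡⟨ collect (+ (n C 0)) t g y ⟩
  + (n C 0) + t * (g + y)    ≡⟨ cong (λ c → + c + t * (g + y)) (trans (nC0≡1 n) (sym (nC0≡1 (suc n)))) ⟩
  + (suc n C 0) + t * (g + y) ∎
  where
  open ≡-Reasoning
  y = (1ℤ + t) ^ n
  g = binomialTail t 1 n
  expand : ∀ t y → (1ℤ + t) * y ≡ y + t * y
  expand = solve-∀
  collect : ∀ c t g y → c + t * g + t * y ≡ c + t * (g + y)
  collect = solve-∀
binomialTail-step t (suc j) zero = begin
  0ℤ                        ≡⟨ zero-expand t ⟩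
  0ℤ + t * 0ℤ               ≡⟨ cong (λ c → + c + t * 0ℤ) (k>n⇒nCk≡0 {0} {suc j} (s≤s z≤n)) ⟨
  + (0 C suc j) + t * 0ℤ    ∎
  where
  open ≡-Reasoning
  zero-expand : ∀ t → 0ℤ ≡ 0ℤ + t * 0ℤ
  zero-expand = solve-∀
binomialTail-step t (suc j) (suc n) = begin
  g₁ + binomialTail t j n
    ≡⟨ cong₂ _+_ (binomialTail-step t (suc j) n) (binomialTail-step t j n) ⟩
  (+ (n C suc j) + t * g₂) + (+ (n C j) + t * g₁)
    ≡⟨ collect (+ (n C suc j)) (+ (n C j)) t g₂ g₁ ⟩
  (+ (n C j) + + (n C suc j)) + t * (g₂ + g₁)
    ≡⟨ cong (_+ t * (g₂ + g₁)) (cong +_ (nCk+nC[k+1]≡[n+1]C[k+1] n j)) ⟩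
  + (suc n C suc j) + t * (g₂ + g₁) ∎
  where
  open ≡-Reasoning
  g₁ = binomialTail t (suc j) n
  g₂ = binomialTail t (suc (suc j)) n
  collect : ∀ c d t g h → (c + t * g) + (d + t * h) ≡ (d + c) + t * (g + h)
  collect = solve-∀

binomialTail-empty : ∀ t {j n} → n ℕ.< j → binomialTail t j n ≡ 0ℤ
binomialTail-empty t {suc j} {zero}  _         = refl
binomialTail-empty t {suc j} {suc n} (s≤s n<j) =
  cong₂ _+_ (binomialTail-empty t (ℕ.m≤n⇒m≤1+n n<j)) (binomialTail-empty t n<j)

-- Both sides are ((1 + t)^n - 1) / t. Induction on `n` avoids the division and so covers `t = 0`.
geomℤ-binomialTail : ∀ t n → geomℤ (1ℤ + t) n ≡ binomialTail t 1 n
geomℤ-binomialTail t zero    = refl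
geomℤ-binomialTail t (suc n) = begin
  1ℤ + (1ℤ + t) * geomℤ (1ℤ + t) n  ≡⟨ cong (λ g → 1ℤ + (1ℤ + t) * g) (geomℤ-binomialTail t n) ⟩
  1ℤ + (1ℤ + t) * g                 ≡⟨ expand t g ⟩
  g + (1ℤ + t * g)                  ≡⟨ cong (λ c → g + (+ c + t * g)) (nC0≡1 n) ⟨
  g + (+ (n C 0) + t * g)           ≡⟨ cong (_+_ g) (binomialTail-step t 0 n) ⟨
  g + (1ℤ + t) ^ n                  ∎
  where
  open ≡-Reasoning
  g = binomialTail t 1 n
  expand : ∀ t g → 1ℤ + (1ℤ + t) * g ≡ g + (1ℤ + t * g)
  expand = solve-∀

-- The term k = 1 cancels `n`. The factor 2 clears the denominator of C(n,2), and for p = 2 it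
-- supplies the power of p that the higher terms would otherwise lack.
geomℤ-expansion : ∀ t n → + 2 * (geomℤ (1ℤ + t) n - + n)
                ≡ + n * (+ n - 1ℤ) * t + + 2 * t ^ 2 * binomialTail t 3 n
geomℤ-expansion t n = begin
  + 2 * (geomℤ (1ℤ + t) n - + n)
    ≡⟨ cong (λ g → + 2 * (g - + n)) (trans (geomℤ-binomialTail t n) (binomialTail-step t 1 n)) ⟩
  + 2 * (+ (n C 1) + t * binomialTail t 2 n - + n)
    ≡⟨ cong₂ (λ c g → + 2 * (+ c + t * g - + n)) (nC1≡n n) (binomialTail-step t 2 n) ⟩
  + 2 * (+ n + t * (+ (n C 2) + t * h) - + n)
    ≡⟨ expand (+ n) t (+ (n C 2)) h ⟩
  + 2 * + (n C 2) * t + + 2 * t ^ 2 * h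
    ≡⟨ cong (λ c → c * t + + 2 * t ^ 2 * h) (2*nC2 n) ⟩
  + n * (+ n - 1ℤ) * t + + 2 * t ^ 2 * h ∎
  where
  open ≡-Reasoning
  h = binomialTail t 3 n
  expand : ∀ n t c h → + 2 * (n + t * (c + t * h) + - n) ≡ + 2 * c * t + + 2 * (t * (t * 1ℤ)) * h
  expand = solve-∀

-- Divisibility between powers, and growth estimates.

^-mono-∣ : ∀ {m t} n → + m ∣ t → + (m ℕ.^ n) ∣ t ^ n
^-mono-∣         zero    _ = ∣-refl
^-mono-∣ {m} {t} (suc n) h = subst (_∣ t * t ^ n) (sym (pos-* m (m ℕ.^ n)))
  (∣-trans (*-monoˡ-∣ (+ (m ℕ.^ n)) h) (*-monoʳ-∣ t (^-mono-∣ n h)))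

^-monoʳ-∣ : ∀ p {m n} → m ℕ.≤ n → + (p ℕ.^ m) ∣ + (p ℕ.^ n)
^-monoʳ-∣ p {m} {n} m≤n = subst (λ k → + (p ℕ.^ m) ∣ + (p ℕ.^ k)) (ℕ.m+[n∸m]≡n m≤n) (pow∣pow p m (n ℕ.∸ m))

-- Used when some p^a ≥ 4 divides `t`. At `k = 0` it reads 3 < 4, which would fail for base 3: this
-- is the source of the exception p = 3.
k+3<4^[k+1] : ∀ k → 3 ℕ.+ k ℕ.< 4 ℕ.^ suc k
k+3<4^[k+1] zero    = ℕ.≤-refl
k+3<4^[k+1] (suc k) = begin-strict
  3 ℕ.+ suc k            ≡⟨ ℕ.+-suc 3 k ⟩
  1 ℕ.+ (3 ℕ.+ k)        <⟨ ℕ.+-mono-≤-< (ℕ.m^n>0 4 (suc k)) (k+3<4^[k+1] k) ⟩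
  x ℕ.+ x                ≤⟨ ℕ.+-monoʳ-≤ x (ℕ.m≤m+n x (2 ℕ.* x)) ⟩
  4 ℕ.^ suc (suc k)      ∎
  where
  open ℕ.≤-Reasoning
  x = 4 ℕ.^ suc k

-- Used for p = 2, where the factor 2 in `2 * t ^ suc k` raises the available exponent from `k + 1`
-- to `k + 2`.
k+3<2^[k+2] : ∀ k → 3 ℕ.+ k ℕ.< 2 ℕ.^ (2 ℕ.+ k)
k+3<2^[k+2] zero    = ℕ.≤-refl
k+3<2^[k+2] (suc k) = begin-strict
  3 ℕ.+ suc k            ≡⟨ ℕ.+-suc 3 k ⟩
  1 ℕ.+ (3 ℕ.+ k)        <⟨ ℕ.+-mono-≤-< (ℕ.m^n>0 2 (2 ℕ.+ k)) (k+3<2^[k+2] k) ⟩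
  x ℕ.+ x                ≤⟨ ℕ.+-monoʳ-≤ x (ℕ.m≤m+n x 0) ⟩
  2 ℕ.^ suc (2 ℕ.+ k)    ∎
  where
  open ℕ.≤-Reasoning
  x = 2 ℕ.^ (2 ℕ.+ k)

-- Prime powers dividing integers, and the localisation at p.

module _ {p : ℕ} (p-prime : Prime p) where

  private
    instance
      p≢0 : NonZero p
      p≢0 = prime⇒nonZero p-prime

    1<p : 1 ℕ.< p
    1<p = ℕ.nonTrivial⇒n>1 p {{prime⇒nonTrivial p-prime}}

    p^[1+n]≡ : ∀ n → + (p ℕ.^ suc n) ≡ + (p ℕ.^ n) * + p
    p^[1+n]≡ n = trans (cong +_ (ℕ.*-comm p (p ℕ.^ n))) (pos-* (p ℕ.^ n) p)

  ^-cancelʳ-< : ∀ {m n} → p ℕ.^ m ℕ.< p ℕ.^ n → m ℕ.< n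
  ^-cancelʳ-< h = ℕ.≰⇒> λ n≤m → ℕ.<⇒≱ h (ℕ.^-monoʳ-≤ p n≤m)

  prime-∣-* : ∀ a b → + p ∣ a * b → + p ∣ a ⊎ + p ∣ b
  prime-∣-* a b h =
    [ (λ k → inj₁ (∣ᵤ⇒∣ k)) , (λ k → inj₂ (∣ᵤ⇒∣ k)) ]′
      (euclidsLemma (abs a) (abs b) p-prime (subst (p ℕ∣.∣_) (ℤ.abs-* a b) (∣⇒∣ᵤ h)))

  prime∤1 : ¬ (+ p ∣ 1ℤ)
  prime∤1 h = ℕ.<⇒≢ 1<p (sym (ℕ∣.∣1⇒≡1 (∣⇒∣ᵤ h)))

  -- If `a` has valuation at most `m`, the remaining `n` factors p must lie in `b`. Euclid's lemma
  -- finds a factor divisible by p; unless that already settles the claim, one p is cancelled there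
  -- and `m` or `n` drops.
  prime-power-∣-* : ∀ m n a b → + (p ℕ.^ (m ℕ.+ n)) ∣ a * b →
                    + (p ℕ.^ suc m) ∣ a ⊎ + (p ℕ.^ n) ∣ b
  prime-power-∣-* m zero a b h = inj₂ (divides b (sym (ℤ.*-identityʳ b)))
  prime-power-∣-* m (suc n) a b h
    with prime-∣-* a b (∣-trans (divides (+ (p ℕ.^ (m ℕ.+ n)))
           (trans (cong (λ k → + (p ℕ.^ k)) (ℕ.+-suc m n)) (p^[1+n]≡ (m ℕ.+ n)))) h)
  ... | inj₂ (divides b′ refl)
    with prime-power-∣-* m n a b′ (*-cancelʳ-∣ (+ p) (subst₂ _∣_
           (trans (cong (λ k → + (p ℕ.^ k)) (ℕ.+-suc m n)) (p^[1+n]≡ (m ℕ.+ n)))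
           (sym (ℤ.*-assoc a b′ (+ p))) h))
  ...   | inj₁ k = inj₁ k
  ...   | inj₂ k = inj₂ (subst (_∣ b′ * + p) (sym (p^[1+n]≡ n)) (*-monoˡ-∣ (+ p) k))
  prime-power-∣-* zero (suc n) a b h | inj₁ k =
    inj₁ (subst (_∣ a) (cong +_ (sym (ℕ.*-identityʳ p))) k)
  prime-power-∣-* (suc m) (suc n) a b h | inj₁ (divides a′ refl)
    with prime-power-∣-* m (suc n) a′ b (*-cancelʳ-∣ (+ p) (subst₂ _∣_
           (p^[1+n]≡ (m ℕ.+ suc n)) (swap a′ (+ p) b) h))
    where
    swap : ∀ a p b → a * p * b ≡ a * b * p
    swap = solve-∀
  ... | inj₁ k = inj₁ (subst (_∣ a′ * + p) (sym (p^[1+n]≡ (suc m))) (*-monoˡ-∣ (+ p) k))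
  ... | inj₂ k = inj₂ k

  prime-power-cancelʳ : ∀ n a {c} → ¬ (+ p ∣ c) → + (p ℕ.^ n) ∣ a * c → + (p ℕ.^ n) ∣ a
  prime-power-cancelʳ n a {c} p∤c h
    -- With `m = 0` the first alternative is p ∣ `c`, which is excluded.
    with prime-power-∣-* 0 n c a (subst (+ (p ℕ.^ n) ∣_) (ℤ.*-comm a c) h)
  ... | inj₁ k = contradiction (subst (λ m → + m ∣ c) (ℕ.*-identityʳ p) k) p∤c
  ... | inj₂ k = k

  prime-∤-* : ∀ {a b} → ¬ (+ p ∣ a) → ¬ (+ p ∣ b) → ¬ (+ p ∣ a * b)
  prime-∤-* {a} {b} p∤a p∤b h = [ p∤a , p∤b ]′ (prime-∣-* a b h)

  prime-power-part : ∀ n → .{{NonZero n}} → ∃[ w ] ∃[ c ] (+ n ≡ + (p ℕ.^ w) * c × ¬ (+ p ∣ c))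
  prime-power-part = <-rec _ go
    where
    go : ∀ n → (∀ {m} → m ℕ.< n → .{{NonZero m}} →
           ∃[ w ] ∃[ c ] (+ m ≡ + (p ℕ.^ w) * c × ¬ (+ p ∣ c))) →
         .{{NonZero n}} → ∃[ w ] ∃[ c ] (+ n ≡ + (p ℕ.^ w) * c × ¬ (+ p ∣ c))
    go n rec with + p ∣? + n
    ... | no  p∤n = 0 , + n , sym (ℤ.*-identityˡ (+ n)) , p∤n
    ... | yes p∣n with ∣⇒∣ᵤ p∣n
    ...   | ℕ∣.divides m refl =
      let instance m≢0 = ℕ.m*n≢0⇒m≢0 m
          w , c , m≡ , p∤c = rec (ℕ.m<m*n m p 1<p)
      in suc w , c , (begin
           + (m ℕ.* p)                ≡⟨ pos-* m p ⟩
           + m * + p                  ≡⟨ cong (_* + p) m≡ ⟩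
           + (p ℕ.^ w) * c * + p      ≡⟨ swap (+ (p ℕ.^ w)) c (+ p) ⟩
           + (p ℕ.^ w) * + p * c      ≡⟨ cong (_* c) (p^[1+n]≡ w) ⟨
           + (p ℕ.^ suc w) * c        ∎) , p∤c
      where
      open ≡-Reasoning
      swap : ∀ a c p → a * c * p ≡ a * p * c
      swap = solve-∀

  -- divisibility in the localisation ℤ₍ₚ₎
  infix 4 _∣ₗ_
  _∣ₗ_ : ℤ → ℤ → Set
  y ∣ₗ x = ∃[ c ] (¬ (+ p ∣ c) × y ∣ c * x)

  ∣ₗ-zero : ∀ {y} → y ∣ₗ 0ℤ
  ∣ₗ-zero = 1ℤ , prime∤1 , divides 0ℤ refl

  ∣ₗ-+ : ∀ {y a b} → y ∣ₗ a → y ∣ₗ b → y ∣ₗ a + b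
  ∣ₗ-+ {y} {a} {b} (c , p∤c , h) (d , p∤d , k) = c * d , prime-∤-* p∤c p∤d ,
    subst (y ∣_) (distribute a b c d) (∣m∣n⇒∣m+n (∣n⇒∣m*n d h) (∣n⇒∣m*n c k))
    where
    distribute : ∀ a b c d → d * (c * a) + c * (d * b) ≡ c * d * (a + b)
    distribute = solve-∀

  -- Of two consecutive integers at most one is divisible by p.
  consecutive-prime-power-part : ∀ k → ∃[ w ] ∃[ d ]
    (+ ((2 ℕ.+ k) ℕ.* (1 ℕ.+ k)) ≡ + (p ℕ.^ w) * d × ¬ (+ p ∣ d) × p ℕ.^ w ℕ.≤ 2 ℕ.+ k)
  consecutive-prime-power-part k
    with prime-power-part (2 ℕ.+ k) | prime-power-part (1 ℕ.+ k)
  ... | suc u , c , c≡ , _ | suc v , d , d≡ , _ =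
    ⊥-elim (prime∤1 (∣m+n∣m⇒∣n {m = + (1 ℕ.+ k)}
      (subst (+ p ∣_) (trans (sym c≡) (cong +_ (ℕ.+-comm 1 (1 ℕ.+ k)))) (p∣ u c))
      (subst (+ p ∣_) (sym d≡) (p∣ v d))))
    where
    p∣ : ∀ w c → + p ∣ + (p ℕ.^ suc w) * c
    p∣ w c = ∣m⇒∣m*n c (divides (+ (p ℕ.^ w)) (p^[1+n]≡ w))
  ... | u , c , c≡ , p∤c | zero , d , d≡ , p∤d =
    u , c * d , (begin
      + ((2 ℕ.+ k) ℕ.* (1 ℕ.+ k))      ≡⟨ pos-* (2 ℕ.+ k) (1 ℕ.+ k) ⟩
      + (2 ℕ.+ k) * + (1 ℕ.+ k)        ≡⟨ cong₂ _*_ c≡ (trans d≡ (ℤ.*-identityˡ d)) ⟩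
      + (p ℕ.^ u) * c * d              ≡⟨ ℤ.*-assoc (+ (p ℕ.^ u)) c d ⟩
      + (p ℕ.^ u) * (c * d)            ∎) ,
    prime-∤-* p∤c p∤d ,
    ℕ∣.∣⇒≤ (∣⇒∣ᵤ (divides c (trans c≡ (ℤ.*-comm (+ (p ℕ.^ u)) c))))
    where open ≡-Reasoning
  ... | zero , c , c≡ , p∤c | v@(suc _) , d , d≡ , p∤d =
    v , c * d , (begin
      + ((2 ℕ.+ k) ℕ.* (1 ℕ.+ k))      ≡⟨ pos-* (2 ℕ.+ k) (1 ℕ.+ k) ⟩
      + (2 ℕ.+ k) * + (1 ℕ.+ k)        ≡⟨ cong₂ _*_ (trans c≡ (ℤ.*-identityˡ c)) d≡ ⟩
      c * (+ (p ℕ.^ v) * d)            ≡⟨ swap c (+ (p ℕ.^ v)) d ⟩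
      + (p ℕ.^ v) * (c * d)            ∎) ,
    prime-∤-* p∤c p∤d ,
    ℕ.m≤n⇒m≤1+n (ℕ∣.∣⇒≤ (∣⇒∣ᵤ (divides d (trans d≡ (ℤ.*-comm (+ (p ℕ.^ v)) d)))))
    where
    open ≡-Reasoning
    swap : ∀ c q d → c * (q * d) ≡ q * (c * d)
    swap = solve-∀

  -- The terms of degree at least three.

  -- In terms of valuations: ⌊log_p (k + 2)⌋ < v(2) + k v(t) for all k ≥ 1.
  SmallStep : ℤ → Set
  SmallStep t = ∀ w k → p ℕ.^ w ℕ.≤ 3 ℕ.+ k → + (p ℕ.^ suc w) ∣ + 2 * t ^ suc k

  module _ {t : ℤ} (small : SmallStep t) (n : ℕ) where

    private
      M = + n * (+ n - 1ℤ) * t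

    -- Write (k+3)(k+2) = p^w d with p ∤ `d`. Then `small` lets 2 t^(k+1) absorb p^w with one p to
    -- spare, while the remaining factor `t` and the absorption identity supply `M`. The multiplier
    -- for the localisation is `d`.
    term-divisible : ∀ k → + p * M ∣ₗ + 2 * t ^ (2 ℕ.+ k) * + (n C (3 ℕ.+ k))
    term-divisible k
      with consecutive-prime-power-part (suc k) | n[n-1]∣k[k-1]nCk n (suc k)
    ... | w , d , kk≡ , p∤d , p^w≤ | divides e e≡ with small w k p^w≤
    -- The claim is first multiplied by `P`, so that `P * d` can be replaced by (k+3)(k+2); then `P`
    -- is cancelled.
    ... | divides r r≡ = d , p∤d , *-cancelˡ-∣ P (divides (r * e) (begin
      P * (d * (+ 2 * (t * T) * B))        ≡⟨ rearrange P d (+ 2) t T B ⟩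
      (+ 2 * T) * t * ((P * d) * B)        ≡⟨ cong₂ (λ u v → u * t * (v * B)) r≡ (sym kk≡) ⟩
      (r * + (p ℕ.^ suc w)) * t * (+ ((3 ℕ.+ k) ℕ.* (2 ℕ.+ k)) * B)
        ≡⟨ cong₂ (λ u v → (r * u) * t * v) (p^[1+n]≡ w) e≡ ⟩
      (r * (P * + p)) * t * (e * N)        ≡⟨ collect r P (+ p) t e N ⟩
      (r * e) * (P * (+ p * M))            ∎))
      where
      open ≡-Reasoning
      instance
        p^w≢0 : NonZero (p ℕ.^ w)
        p^w≢0 = ℕ.m^n≢0 p w
      P = + (p ℕ.^ w)
      T = t ^ suc k
      B = + (n C (3 ℕ.+ k))
      N = + n * (+ n - 1ℤ)
      rearrange : ∀ P d two t T B → P * (d * (two * (t * T) * B)) ≡ (two * T) * t * ((P * d) * B)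
      rearrange = solve-∀
      collect : ∀ r P p t e N → (r * (P * p)) * t * (e * N) ≡ (r * e) * (P * (p * (N * t)))
      collect = solve-∀

    -- Here `d` bounds the number of terms left in the tail. The induction adds one term at a time
    -- and ends with an empty tail.
    binomialTail-divisible : ∀ d k → n ℕ.< (3 ℕ.+ k) ℕ.+ d →
                             + p * M ∣ₗ + 2 * t ^ (2 ℕ.+ k) * binomialTail t (3 ℕ.+ k) n
    binomialTail-divisible zero k n< = subst (+ p * M ∣ₗ_)
      (sym (trans (cong (+ 2 * t ^ (2 ℕ.+ k) *_)
             (binomialTail-empty t (subst (n ℕ.<_) (ℕ.+-identityʳ (3 ℕ.+ k)) n<)))
           (ℤ.*-zeroʳ (+ 2 * t ^ (2 ℕ.+ k)))))
      ∣ₗ-zero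
    binomialTail-divisible (suc d) k n< = subst (+ p * M ∣ₗ_)
      (trans (distribute (+ 2) (t ^ (2 ℕ.+ k)) (+ (n C (3 ℕ.+ k))) t (binomialTail t (4 ℕ.+ k) n))
             (cong (+ 2 * t ^ (2 ℕ.+ k) *_) (sym (binomialTail-step t (3 ℕ.+ k) n))))
      (∣ₗ-+ (term-divisible k)
            (binomialTail-divisible d (suc k) (subst (n ℕ.<_) (ℕ.+-suc (3 ℕ.+ k) d) n<)))
      where
      distribute : ∀ two T c t g → two * T * c + two * (t * T) * g ≡ two * T * (c + t * g)
      distribute = solve-∀

    -- The higher terms change `M` only by a unit of ℤ₍ₚ₎: up to the multiplier `c`, the whole
    -- expansion is `M * (c + e * p)`, and p does not divide `c + e * p` because it does not divide
    -- `c`.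
    p^∣geomℤ-n⇒p^∣n[n-1]t : ∀ N → + (p ℕ.^ N) ∣ geomℤ (1ℤ + t) n - + n → + (p ℕ.^ N) ∣ M
    p^∣geomℤ-n⇒p^∣n[n-1]t N h with binomialTail-divisible n 0 (ℕ.m≤n+m (suc n) 2)
    ... | c , p∤c , divides e e≡ = prime-power-cancelʳ N M
      (λ p∣ → p∤c (∣m+n∣n⇒∣m {m = c} p∣ (divides e refl)))
      (subst (+ (p ℕ.^ N) ∣_) (begin
        c * (+ 2 * (geomℤ (1ℤ + t) n - + n))  ≡⟨ cong (c *_) (geomℤ-expansion t n) ⟩
        c * (M + S)                           ≡⟨ ℤ.*-distribˡ-+ c M S ⟩
        c * M + c * S                         ≡⟨ cong (_+_ (c * M)) e≡ ⟩
        c * M + e * (+ p * M)                 ≡⟨ factor c M e (+ p) ⟩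
        M * (c + e * + p)                     ∎)
        (∣n⇒∣m*n c (∣n⇒∣m*n (+ 2) h)))
      where
      open ≡-Reasoning
      S = + 2 * t ^ 2 * binomialTail t 3 n
      factor : ∀ c M e p → c * M + e * (p * M) ≡ M * (c + e * p)
      factor = solve-∀

  -- From p^w ≤ k+3 < 4^(k+1) ≤ p^(a(k+1)) it follows that w < a(k+1), and p^(a(k+1)) divides
  -- t^(k+1). The uses are a = 1 for p ≥ 4 and a = 2 for `q` in `U 2`.
  smallStep-of-large : ∀ {t} a → 4 ℕ.≤ p ℕ.^ a → + (p ℕ.^ a) ∣ t → SmallStep t
  smallStep-of-large {t} a 4≤ h w k p^w≤ = ∣n⇒∣m*n (+ 2) (∣-trans
    (^-monoʳ-∣ p (^-cancelʳ-< {w} {a ℕ.* suc k} (begin-strict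
      p ℕ.^ w                   ≤⟨ p^w≤ ⟩
      3 ℕ.+ k                   <⟨ k+3<4^[k+1] k ⟩
      4 ℕ.^ suc k               ≤⟨ ℕ.^-monoˡ-≤ (suc k) 4≤ ⟩
      (p ℕ.^ a) ℕ.^ suc k       ≡⟨ ℕ.^-*-assoc p a (suc k) ⟩
      p ℕ.^ (a ℕ.* suc k)       ∎)))
    (subst (_∣ t ^ suc k) (cong +_ (ℕ.^-*-assoc p a (suc k))) (^-mono-∣ (suc k) h)))
    where open ℕ.≤-Reasoning

-- From 2^w ≤ k+3 < 2^(k+2) it follows that w ≤ k+1. Hence t^(k+1) supplies 2^w, and the explicit
-- factor 2 supplies the last one.
smallStep-two : ∀ {p} (p-prime : Prime p) → p ≡ 2 → ∀ {t} → + p ∣ t → SmallStep p-prime t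
smallStep-two p-prime refl {t} h w k 2^w≤ = subst (_∣ + 2 * t ^ suc k) (sym (pos-* 2 (2 ℕ.^ w)))
  (*-monoʳ-∣ (+ 2) (∣-trans
    (^-monoʳ-∣ 2 (ℕ.≤-pred (^-cancelʳ-< p-prime {w} {2 ℕ.+ k}
      (ℕ.≤-<-trans 2^w≤ (k+3<2^[k+2] k)))))
    (^-mono-∣ (suc k) h)))

-- Zero products in ℤₚ.

∣⇒mod-zero : ∀ {a d} → d ∣ a → a ≡ 0ℤ [mod d ]
∣⇒mod-zero {a} h = modEq (subst (_ ∣_) (sym (ℤ.+-identityʳ a)) h)

residue-stableʳ : ∀ {p} (x : ℤₚ p) m n → residue x (m ℕ.+ n) ≡ residue x n [mod + (p ℕ.^ n) ]
residue-stableʳ x m n rewrite ℕ.+-comm m n = residue-stable x n m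

x-y≈0⇒x≈y : ∀ {p} {x y : ℤₚ p} → x +ₚ -ₚ y ≈ 0# → x ≈ y
x-y≈0⇒x≈y h = mk≈ λ n → modEq (mod-zero⇒∣ (residue-≡ h n))

module _ {p : ℕ} (p-prime : Prime p) where

  private
    instance
      p≢0 : NonZero p
      p≢0 = prime⇒nonZero p-prime

  -- Congruence modulo pⁿ is decidable, so u ≈ 0# is stable under double negation;
  -- refuting it gives an n with pⁿ ∤ u, and then p^(n+m) ∣ u v forces pᵐ ∣ v for all m.
  x*y≈0⇒x≈0 : ∀ (u v : ℤₚ p) → u *ₚ v ≈ 0# → ¬ (v ≈ 0#) → u ≈ 0#
  x*y≈0⇒x≈0 u v uv≈0 v≉0 = mk≈ λ n → ∣⇒mod-zero (decidable-stable (+ (p ℕ.^ n) ∣? residue u n)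
    λ p^n∤u → v≉0 (mk≈ λ m → ∣⇒mod-zero
      ([ (λ p^1+n∣u → contradiction (p^n∣residue u n m (∣-trans (^-monoʳ-∣ p (ℕ.n≤1+n n)) p^1+n∣u)) p^n∤u)
       , p^m∣residue v n m ]′
       (prime-power-∣-* p-prime n m (residue u (n ℕ.+ m)) (residue v (n ℕ.+ m))
         (mod-zero⇒∣ (residue-≡ uv≈0 (n ℕ.+ m)))))))
    where
    p^n∣residue : ∀ (x : ℤₚ p) n m → + (p ℕ.^ n) ∣ residue x (n ℕ.+ m) → + (p ℕ.^ n) ∣ residue x n
    p^n∣residue x n m h = mod-zero⇒∣ (mod-trans (mod-sym (residue-stable x n m)) (∣⇒mod-zero h))
    p^m∣residue : ∀ (x : ℤₚ p) n m → + (p ℕ.^ m) ∣ residue x (n ℕ.+ m) → + (p ℕ.^ m) ∣ residue x m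
    p^m∣residue x n m h = mod-zero⇒∣ (mod-trans (mod-sym (residue-stableʳ x n m)) (∣⇒mod-zero h))

  -- Since p cannot divide both `x` and `x - 1`, the residue of `x` modulo p decides which factor is
  -- certainly nonzero. This replaces a case split on equality in ℤₚ.
  x[x-1]≈0⇒x≈0⊎x≈1 : ∀ (x : ℤₚ p) → x *ₚ (x +ₚ -ₚ 1#) ≈ 0# → x ≈ 0# ⊎ x ≈ 1#
  x[x-1]≈0⇒x≈0⊎x≈1 x h =
    [ (λ p∣x → inj₁ (x*y≈0⇒x≈0 x (x +ₚ -ₚ 1#) h λ x-1≈0 →
        prime∤1 p-prime (∣-trans (subst (λ k → + p ∣ + k) (sym (ℕ.*-identityʳ p)) ∣-refl)
          (∣m⇒∣-m (∣m+n∣m⇒∣n (mod-zero⇒∣ (residue-≡ x-1≈0 1)) p∣x)))))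
    , (λ p∤x → inj₂ (x-y≈0⇒x≈y (x*y≈0⇒x≈0 (x +ₚ -ₚ 1#) x
        (≈-trans (*-comm (x +ₚ -ₚ 1#) x) h) λ x≈0 → p∤x (mod-zero⇒∣ (residue-≡ x≈0 1)))))
    ]′ (toSum (+ (p ℕ.^ 1) ∣? residue x 1))
    where open IsCommutativeRing isCommutativeRing using (*-comm) renaming (trans to ≈-trans)

  -- Fixed points of the bracket.

  smallStep-residue : ∀ {q : ℤₚ p} → q ∈ U 1 → p ≢ 3 ⊎ q ∈ U 2 →
                      ∀ n → SmallStep p-prime (residue q (2 ℕ.+ n) - 1ℤ)
  smallStep-residue {q} q∈U₁ hyp n =
    [ (λ p≡2 → smallStep-two p-prime p≡2 p∣t)
    , (λ p≢2 → [ (λ p≢3 → smallStep-≥4 p≢2 p≢3)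
               , (λ q∈U₂ → smallStep-U₂ p≢2 q∈U₂) ]′ hyp)
    ]′ (toSum (p ℕ.≟ 2))
    where
    -- The index is at least 2, so that the residue also reflects a congruence of `q` modulo p².
    t = residue q (2 ℕ.+ n) - 1ℤ
    p∣t : + p ∣ t
    p∣t = divides-difference (U₁-residue q∈U₁ (suc n))
    3≤p : p ≢ 2 → 3 ℕ.≤ p
    3≤p p≢2 = ℕ.≤∧≢⇒< (ℕ.nonTrivial⇒n>1 p {{prime⇒nonTrivial p-prime}}) (≢-sym p≢2)
    smallStep-≥4 : p ≢ 2 → p ≢ 3 → SmallStep p-prime t
    smallStep-≥4 p≢2 p≢3 = smallStep-of-large p-prime 1
      (subst (4 ℕ.≤_) (sym (ℕ.*-identityʳ p)) (ℕ.≤∧≢⇒< (3≤p p≢2) (≢-sym p≢3)))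
      (subst (λ k → + k ∣ t) (sym (ℕ.*-identityʳ p)) p∣t)
    smallStep-U₂ : p ≢ 2 → q ∈ U 2 → SmallStep p-prime t
    smallStep-U₂ p≢2 q∈U₂ = smallStep-of-large p-prime 2
      (ℕ.≤-trans (ℕ.m≤m+n 4 5) (ℕ.^-monoˡ-≤ 2 (3≤p p≢2)))
      (divides-difference (mod-trans (residue-stable q 2 n) (modp^⇒residue q 1# 2 q∈U₂)))

  -- By definition the residue of `ι` at level `N` is the geometric sum of `approx z N` terms in
  -- `residue q N`, so the integer result applies to it directly.
  fixedPoint⇒product≈0 : ∀ {q : ℤₚ p} (q∈U₁ : q ∈ U 1) → p ≢ 3 ⊎ q ∈ U 2 →
    ∀ z → ι q q∈U₁ z ≈ z → z *ₚ (z +ₚ -ₚ 1#) *ₚ (q +ₚ -ₚ 1#) ≈ 0#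
  fixedPoint⇒product≈0 {q} q∈U₁ hyp z fixed = mk≈ λ k →
    -- Working two levels up makes `smallStep-residue` applicable; the divisibility by p^N is
    -- weakened to p^k at the end.
    let N  = 2 ℕ.+ k
        n  = approx z N
        x  = residue q N
        geom≡n : geomℤ (1ℤ + (x - 1ℤ)) n ≡ + n [mod + (p ℕ.^ N) ]
        geom≡n = mod-trans (mod-reflexive (cong (λ y → geomℤ y n) (1+[x-1]≡x x)))
                   (mod-trans (residue-≡ fixed N) (mod-sym (approx-≡ z N)))
        product∣ = p^∣geomℤ-n⇒p^∣n[n-1]t p-prime (smallStep-residue q∈U₁ hyp k) n N
                     (divides-difference geom≡n)
        z≡n = mod-trans (mod-sym (residue-stableʳ z 2 k))
                (mod-weaken (^-monoʳ-∣ p (ℕ.m≤n+m k 2)) (mod-sym (approx-≡ z N)))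
    in mod-trans
         (mod-* (mod-* z≡n (mod-+ z≡n mod-refl))
                (mod-+ (mod-sym (residue-stableʳ q 2 k)) mod-refl))
         (∣⇒mod-zero (∣-trans (^-monoʳ-∣ p (ℕ.m≤n+m k 2)) product∣))
    where
    1+[x-1]≡x : ∀ x → 1ℤ + (x + - 1ℤ) ≡ x
    1+[x-1]≡x = solve-∀

-- Continuity at `y` suffices, because `x ≈ y` places `x` in every neighbourhood of `y`.
bracket-cong : ∀ {p} .{{_ : NonZero p}} {q : ℤₚ p} {f} → IsBracket q f →
               ∀ {x y} → x ≈ y → f x ≈ f y
bracket-cong {f = f} F {x} {y} x≈y = mk≈ λ n →
  let m , near = continuous F y n
  in modp^⇒residue (f x) (f y) n (near x (residue⇒modp^ x y m (residue-≡ x≈y m)))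

corollary4p4 : (p : ℕ) → Prime p →
    (q : ℤₚ p) → q ∈ U 1 → ¬ (q ≈ 1#) →
    (p ≢ 3) ⊎ (q ∈ U 2) →
    (ιq : ℤₚ p → ℤₚ p) → IsBracket q ιq →
    (z : ℤₚ p) → (ιq z ≈ z) ⇔ ((z ≈ 0#) ⊎ (z ≈ 1#))
corollary4p4 p p-prime q q∈U₁ q≉1 hyp ιq isBracket z = mk⇔ fixed⇒trivial trivial⇒fixed
  where
  open IsCommutativeRing (isCommutativeRing {p})
    using (+-identityʳ) renaming (sym to ≈-sym; trans to ≈-trans)
  instance
    p≢0 : NonZero p
    p≢0 = prime⇒nonZero p-prime
  fixed⇒trivial : ιq z ≈ z → z ≈ 0# ⊎ z ≈ 1#
  fixed⇒trivial fixed = x[x-1]≈0⇒x≈0⊎x≈1 p-prime z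
    -- The factor `q - 1` is nonzero and cancels. Uniqueness of the bracket carries the fixed point
    -- from `ιq` to `ι`.
    (x*y≈0⇒x≈0 p-prime (z *ₚ (z +ₚ -ₚ 1#)) (q +ₚ -ₚ 1#)
      (fixedPoint⇒product≈0 p-prime q∈U₁ hyp z
        (≈-trans (bracket-unique (ι-isBracket q q∈U₁) isBracket z) fixed))
      (λ q-1≈0 → q≉1 (x-y≈0⇒x≈y q-1≈0)))
  -- The geometric sum is empty for 0, and for 1 it is `1# +ₚ 0#`.
  trivial⇒fixed : z ≈ 0# ⊎ z ≈ 1# → ιq z ≈ z
  trivial⇒fixed (inj₁ z≈0) =
    ≈-trans (bracket-cong isBracket z≈0) (≈-trans (on-ℕ isBracket 0) (≈-sym z≈0))
  trivial⇒fixed (inj₂ z≈1) =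
    ≈-trans (bracket-cong isBracket z≈1)
      (≈-trans (on-ℕ isBracket 1) (≈-trans (+-identityʳ 1#) (≈-sym z≈1)))
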